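{- A formula $\psi\in E(\mathcal{P})$ is a property of the abstract system (i.e. $\langle\psi\rangle_{\sigma_{\mathcal{P}}}=\mathbf{true}$ for all $\sigma_{\mathcal{P}}\in R_A$) if and only if the concrete property $\forall\mathcal{X}\,\psi^{*}$ has an induction proof over the predicate set $\phi$.
   Context: **Logic.** Symbols are Boolean, integer, function (mapping integer tuples to integers) or predicate (mapping integer tuples to Booleans) symbols. CLU expressions are given by: Boolean expressions $b ::= \mathbf{true}\mid\mathbf{false}\mid$ Boolean symbol $\mid\neg b\mid b\wedge b\mid t=t\mid t<t\mid p(t,\dots,t)$; integer expressions $t ::=$ lambda-bound variable $\mid$ integer symbol $\mid \mathit{ITE}(b,t,t)$ (if-then-else) $\mid t+c$ ($c$ an integer constant) $\mid f(t,\dots,t)$; predicate expressions $p ::=$ predicate symbol $\mid\lambda x_1,\dots,x_k.\,b$; function expressions $f ::=$ function symbol $\mid \lambda x_1,\dots,x_k.\,t$ (lambda variables are integers). For a set of symbols $\mathcal{A}$, $E(\mathcal{A})$ is the set of CLU expressions over $\mathcal{A}$; $\Sigma_{\mathcal{A}}$ is the set of interpretations $\sigma_{\mathcal{A}}$, each assigning to every symbol of $\mathcal{A}$ a value of the appropriate type; $\langle\theta\rangle_{\sigma_{\mathcal{A}}}$ is the value of $\theta\in E(\mathcal{A})$ under $\sigma_{\mathcal{A}}$. For disjoint $\mathcal{A},\mathcal{B}$, $\sigma_{\mathcal{A}}\cdot\sigma_{\mathcal{B}}$ is the combined interpretation of $\mathcal{A}\cup\mathcal{B}$. A named set $v$ over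 $\mathcal{A}$ of expressions over $\mathcal{B}$ has an expression $v_x\in E(\mathcal{B})$ of the type of $x$ for each $x\in\mathcal{A}$; $\langle v\rangle_{\sigma_{\mathcal{B}}}\in\Sigma_{\mathcal{A}}$ is the interpretation $x\mapsto\langle v_x\rangle_{\sigma_{\mathcal{B}}}$. $\theta[v/\mathcal{A}]$ is the result of simultaneously replacing each $x\in\mathcal{A}$ in $\theta$ by $v_x$. **Concrete system.** Pairwise disjoint symbol sets: state symbols $\mathcal{V}$, initial-state symbols $\mathcal{J}$, input symbols $\mathcal{I}$, index symbols $\mathcal{X}$, and a finite set $\mathcal{P}$ of Boolean predicate symbols. The system is given by expressions $q^0_x\in E(\mathcal{J})$ and $\delta_x\in E(\mathcal{V}\cup\mathcal{I})$ for each $x\in\mathcal{V}$. Concrete states are elements of $\Sigma_{\mathcal{V}}$; $Q^0_C=\{\langle q^0\rangle_{\sigma_{\mathcal{J}}}\mid\sigma_{\mathcal{J}}\in\Sigma_{\mathcal{J}}\}$; $N_C(s)=\{\langle\delta\rangle_{s\cdot\sigma_{\mathcal{I}}}\mid\sigma_{\mathcal{I}}\in\Sigma_{\mathcal{I}}\}$ and $N_C(S_C)=\bigcup_{s\in S_C}N_C(s)$. **Abstraction.** For each $p\in\mathcal{P}$ there is a Boolean expression $\phi_p\in E(\mathcal{V}\cup\mathcal{X})$; $\phi$ is the named set of these, so $\langle\phi\rangle_{s\cdot\sigma_{\mathcal{X}}}\in\Sigma_{\mathcal{P}}$. Abstract states are elements of $\Sigma_{\mathcal{P}}$. $\alpha(s)=\{\langle\phi\rangle_{s\cdot\sigma_{\mathcal{X}}}\mid\sigma_{\mathcal{X}}\in\Sigma_{\mathcal{X}}\}$,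 $\alpha(S_C)=\bigcup_{s\in S_C}\alpha(s)$, $\gamma(S_A)=\{s\mid\forall\sigma_{\mathcal{X}}\in\Sigma_{\mathcal{X}}:\langle\phi\rangle_{s\cdot\sigma_{\mathcal{X}}}\in S_A\}$. **Abstract reachability.** $Q^0_A=\alpha(Q^0_C)$, $N_A(S_A)=\alpha(N_C(\gamma(S_A)))$, $R_A^0=Q_A^0$, $R_A^{i+1}=R_A^i\cup N_A(R_A^i)$, and $R_A$ is the limit $R_A^n$ for $n$ with $R_A^n=R_A^{n+1}$ (which exists since $\Sigma_{\mathcal{P}}$ is finite). **Properties.** For a Boolean formula $\psi\in E(\mathcal{P})$, $\psi^{*}=\psi[\phi/\mathcal{P}]\in E(\mathcal{V}\cup\mathcal{X})$. For a concrete state $s$, $\forall\mathcal{X}\,\psi^{*}(s)$ holds when $\langle\psi^{*}\rangle_{s\cdot\sigma_{\mathcal{X}}}=\mathbf{true}$ for every $\sigma_{\mathcal{X}}\in\Sigma_{\mathcal{X}}$. **Induction.** $\forall\mathcal{X}\,\psi^{*}$ is inductive when (1) every $s\in Q^0_C$ satisfies $\forall\mathcal{X}\,\psi^{*}(s)$, and (2) for all concrete states $s,t$ with $t\in N_C(s)$, if $\forall\mathcal{X}\,\psi^{*}(s)$ holds then $\forall\mathcal{X}\,\psi^{*}(t)$ holds. $\forall\mathcal{X}\,\psi^{*}$ has an induction proof over $\phi$ when there is a Boolean formula $\chi\in E(\mathcal{P})$ such that $\chi\Rightarrow\psi$ (is true under every $\sigma_{\mathcal{P}}\in\Sigma_{\mathcal{P}}$)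 and $\forall\mathcal{X}\,\chi^{*}$ is inductive. -}

module Defs where

open import Data.Bool.Base using (Bool; true; false; not; _∧_; if_then_else_)
open import Data.Fin.Base using (Fin; inject≤)
open import Data.Integer using (ℤ; _+_; _≟_; _<?_)
open import Data.Nat.Base as ℕ using (ℕ; zero; suc; _≤_; z≤n)
open import Data.Nat.Properties using (+-monoʳ-≤)
open import Data.Product.Base using (∃-syntax; _×_)
open import Data.Sum.Base using (_⊎_; inj₁; inj₂)
open import Data.Vec.Base using (Vec; []; _∷_; _++_; lookup)
open import Level using (0ℓ)
open import Relation.Binary.PropositionalEquality using (_≡_)
open import Relation.Nullary.Decidable.Core using (does)
open import Relation.Unary using (Pred; _∈_; _∪_; _≐_)

data Ty : Set where
  bool int  : Ty
  func pred : (k : ℕ) → Ty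

⟦_⟧ᵀ : Ty → Set
⟦ bool ⟧ᵀ   = Bool
⟦ int ⟧ᵀ    = ℤ
⟦ func k ⟧ᵀ = Vec ℤ k → ℤ
⟦ pred k ⟧ᵀ = Vec ℤ k → Bool

-- A set of symbols is given by its symbols of each type.
Symbols : Set₁
Symbols = Ty → Set

-- Union of disjoint symbol sets.
infixr 5 _⊕_
_⊕_ : Symbols → Symbols → Symbols
(𝒜 ⊕ ℬ) τ = 𝒜 τ ⊎ ℬ τ

data BoolSymbols (m : ℕ) : Symbols where
  bsym : Fin m → BoolSymbols m bool

-- CLU expressions over 𝒜 with n lambda-bound variables in scope (de Bruijn).
-- A k-ary lambda puts its own variables in front of those already in scope.
data Expr (𝒜 : Symbols) (n : ℕ) : Ty → Set where
  sym         : ∀ {τ} → 𝒜 τ → Expr 𝒜 n τ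
  tt ff       : Expr 𝒜 n bool
  neg         : Expr 𝒜 n bool → Expr 𝒜 n bool
  and         : Expr 𝒜 n bool → Expr 𝒜 n bool → Expr 𝒜 n bool
  eq lt       : Expr 𝒜 n int → Expr 𝒜 n int → Expr 𝒜 n bool
  papp        : ∀ {k} → Expr 𝒜 n (pred k) → Vec (Expr 𝒜 n int) k → Expr 𝒜 n bool
  var         : Fin n → Expr 𝒜 n int
  ite         : Expr 𝒜 n bool → Expr 𝒜 n int → Expr 𝒜 n int → Expr 𝒜 n int
  plus        : Expr 𝒜 n int → ℤ → Expr 𝒜 n int
  fapp        : ∀ {k} → Expr 𝒜 n (func k) → Vec (Expr 𝒜 n int) k → Expr 𝒜 n int
  plam        : ∀ k → Expr 𝒜 (k ℕ.+ n) bool → Expr 𝒜 n (pred k)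
  flam        : ∀ k → Expr 𝒜 (k ℕ.+ n) int → Expr 𝒜 n (func k)

E : Symbols → Ty → Set
E 𝒜 = Expr 𝒜 0

Interp : Symbols → Set
Interp 𝒜 = ∀ τ → 𝒜 τ → ⟦ τ ⟧ᵀ

-- Equality of values and of interpretations is extensional, since _≡_ on
-- Agda functions is not.
infix 4 _≈ᵀ_ _≈_
_≈ᵀ_ : ∀ {τ} → ⟦ τ ⟧ᵀ → ⟦ τ ⟧ᵀ → Set
_≈ᵀ_ {bool}   a b = a ≡ b
_≈ᵀ_ {int}    a b = a ≡ b
_≈ᵀ_ {func k} f g = ∀ xs → f xs ≡ g xs
_≈ᵀ_ {pred k} f g = ∀ xs → f xs ≡ g xs

_≈_ : ∀ {𝒜} → Interp 𝒜 → Interp 𝒜 → Set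
_≈_ {𝒜} σ σ′ = ∀ τ (x : 𝒜 τ) → _≈ᵀ_ {τ} (σ τ x) (σ′ τ x)

infixr 5 _·_
_·_ : ∀ {𝒜 ℬ} → Interp 𝒜 → Interp ℬ → Interp (𝒜 ⊕ ℬ)
(σ · σ′) τ (inj₁ x) = σ τ x
(σ · σ′) τ (inj₂ y) = σ′ τ y

module _ {𝒜 : Symbols} (σ : Interp 𝒜) where
  mutual
    eval : ∀ {n τ} → Vec ℤ n → Expr 𝒜 n τ → ⟦ τ ⟧ᵀ
    eval ρ (sym x)     = σ _ x
    eval ρ tt          = true
    eval ρ ff          = false
    eval ρ (neg b)     = not (eval ρ b)
    eval ρ (and b c)   = eval ρ b ∧ eval ρ c
    eval ρ (eq t u)    = does (eval ρ t ≟ eval ρ u)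
    eval ρ (lt t u)    = does (eval ρ t <? eval ρ u)
    eval ρ (papp p ts) = eval ρ p (evals ρ ts)
    eval ρ (var i)     = lookup ρ i
    eval ρ (ite b t u) = if eval ρ b then eval ρ t else eval ρ u
    eval ρ (plus t c)  = eval ρ t + c
    eval ρ (fapp f ts) = eval ρ f (evals ρ ts)
    eval ρ (plam k b)  = λ xs → eval (xs ++ ρ) b
    eval ρ (flam k t)  = λ xs → eval (xs ++ ρ) t

    evals : ∀ {n k} → Vec ℤ n → Vec (Expr 𝒜 n int) k → Vec ℤ k
    evals ρ []       = []
    evals ρ (t ∷ ts) = eval ρ t ∷ evals ρ ts

⟨_⟩ : ∀ {𝒜 τ} → E 𝒜 τ → Interp 𝒜 → ⟦ τ ⟧ᵀ
⟨ θ ⟩ σ = eval σ [] θ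

Named : Symbols → Symbols → Set
Named 𝒜 ℬ = ∀ τ → 𝒜 τ → E ℬ τ

⟨_⟩ᴺ : ∀ {𝒜 ℬ} → Named 𝒜 ℬ → Interp ℬ → Interp 𝒜
⟨ v ⟩ᴺ σ τ x = ⟨ v τ x ⟩ σ

-- Weakening by outermost variables: indices keep their numeric value.
mutual
  weaken : ∀ {𝒜 m n τ} → m ≤ n → Expr 𝒜 m τ → Expr 𝒜 n τ
  weaken le (sym x)     = sym x
  weaken le tt          = tt
  weaken le ff          = ff
  weaken le (neg b)     = neg (weaken le b)
  weaken le (and b c)   = and (weaken le b) (weaken le c)
  weaken le (eq t u)    = eq (weaken le t) (weaken le u)
  weaken le (lt t u)    = lt (weaken le t) (weaken le u)
  weaken le (papp p ts) = papp (weaken le p) (weakens le ts)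
  weaken le (var i)     = var (inject≤ i le)
  weaken le (ite b t u) = ite (weaken le b) (weaken le t) (weaken le u)
  weaken le (plus t c)  = plus (weaken le t) c
  weaken le (fapp f ts) = fapp (weaken le f) (weakens le ts)
  weaken le (plam k b)  = plam k (weaken (+-monoʳ-≤ k le) b)
  weaken le (flam k t)  = flam k (weaken (+-monoʳ-≤ k le) t)

  weakens : ∀ {𝒜 m n k} → m ≤ n → Vec (Expr 𝒜 m int) k → Vec (Expr 𝒜 n int) k
  weakens le []       = []
  weakens le (t ∷ ts) = weaken le t ∷ weakens le ts

-- Simultaneous substitution for symbols; the expressions v τ x are closed,
-- so nothing can be captured.
module _ {𝒜 ℬ : Symbols} (v : Named 𝒜 ℬ) where
  mutual
    subst : ∀ {n τ} → Expr 𝒜 n τ → Expr ℬ n τ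
    subst (sym x)     = weaken z≤n (v _ x)
    subst tt          = tt
    subst ff          = ff
    subst (neg b)     = neg (subst b)
    subst (and b c)   = and (subst b) (subst c)
    subst (eq t u)    = eq (subst t) (subst u)
    subst (lt t u)    = lt (subst t) (subst u)
    subst (papp p ts) = papp (subst p) (substs ts)
    subst (var i)     = var i
    subst (ite b t u) = ite (subst b) (subst t) (subst u)
    subst (plus t c)  = plus (subst t) c
    subst (fapp f ts) = fapp (subst f) (substs ts)
    subst (plam k b)  = plam k (subst b)
    subst (flam k t)  = flam k (subst t)

    substs : ∀ {n k} → Vec (Expr 𝒜 n int) k → Vec (Expr ℬ n int) k
    substs []       = []
    substs (t ∷ ts) = subst t ∷ substs ts

_[_] : ∀ {𝒜 ℬ τ} → E 𝒜 τ → Named 𝒜 ℬ → E ℬ τ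
θ [ v ] = subst v θ

record System : Set₁ where
  field
    𝒱 𝒥 ℐ 𝒳 : Symbols
    #𝒫      : ℕ

  𝒫 : Symbols
  𝒫 = BoolSymbols #𝒫

  field
    q⁰ : Named 𝒱 𝒥
    δ  : Named 𝒱 (𝒱 ⊕ ℐ)
    φ  : Named 𝒫 (𝒱 ⊕ 𝒳)

module Semantics (sys : System) where
  open System sys public

  CState AState : Set
  CState = Interp 𝒱
  AState = Interp 𝒫

  Q⁰C : Pred CState 0ℓ
  Q⁰C s = ∃[ σⱼ ] s ≈ ⟨ q⁰ ⟩ᴺ σⱼ

  NC : CState → Pred CState 0ℓ
  NC s t = ∃[ σᵢ ] t ≈ ⟨ δ ⟩ᴺ (s · σᵢ)

  NC⋃ : Pred CState 0ℓ → Pred CState 0ℓ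
  NC⋃ S t = ∃[ s ] s ∈ S × t ∈ NC s

  α : CState → Pred AState 0ℓ
  α s a = ∃[ σₓ ] a ≈ ⟨ φ ⟩ᴺ (s · σₓ)

  α⋃ : Pred CState 0ℓ → Pred AState 0ℓ
  α⋃ S a = ∃[ s ] s ∈ S × a ∈ α s

  γ : Pred AState 0ℓ → Pred CState 0ℓ
  γ A s = ∀ (σₓ : Interp 𝒳) → ⟨ φ ⟩ᴺ (s · σₓ) ∈ A

  Q⁰A : Pred AState 0ℓ
  Q⁰A = α⋃ Q⁰C

  NA : Pred AState 0ℓ → Pred AState 0ℓ
  NA A = α⋃ (NC⋃ (γ A))

  RAᵢ : ℕ → Pred AState 0ℓ
  RAᵢ zero    = Q⁰A
  RAᵢ (suc i) = RAᵢ i ∪ NA (RAᵢ i)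

  -- RAᵢ n for an n at which the sequence is stationary; all such n give the
  -- same set.
  RA : Pred AState 0ℓ
  RA a = ∃[ n ] RAᵢ n ≐ RAᵢ (suc n) × a ∈ RAᵢ n

  AbstractProperty : E 𝒫 bool → Set
  AbstractProperty ψ = ∀ a → a ∈ RA → ⟨ ψ ⟩ a ≡ true

  _* : E 𝒫 bool → E (𝒱 ⊕ 𝒳) bool
  ψ * = ψ [ φ ]

  ∀𝒳 : E (𝒱 ⊕ 𝒳) bool → Pred CState 0ℓ
  ∀𝒳 θ s = ∀ (σₓ : Interp 𝒳) → ⟨ θ ⟩ (s · σₓ) ≡ true

  Inductive : Pred CState 0ℓ → Set
  Inductive Φ = (∀ s → s ∈ Q⁰C → Φ s)
              × (∀ s t → t ∈ NC s → Φ s → Φ t)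

  HasInductionProof : E 𝒫 bool → Set
  HasInductionProof ψ =
    ∃[ χ ] (∀ a → ⟨ χ ⟩ a ≡ true → ⟨ ψ ⟩ a ≡ true) × Inductive (∀𝒳 (χ *))

{-# OPTIONS --safe #-}
-- Substitution commutes with evaluation, so if χ holds exactly on a set A of abstract states, then
-- ∀𝒳 χ* is the predicate γ(A).  Hence the models of χ contain every Rᵢ when ∀𝒳 χ* is inductive.
-- Conversely, Σ_𝒫 is finite, so the sequence becomes stationary at some N, and the formula with
-- models R_N, which exists since every Boolean function of the predicate symbols is expressible,
-- serves as χ.
module Submission where

open import Defs
open import Axiom.ExcludedMiddle using (ExcludedMiddle)
open import Data.Bool.Base using (Bool; true; false; not; _∧_; if_then_else_)
open import Data.Bool.Properties using (∧-identityʳ; not-involutive)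
open import Data.Fin.Base using (Fin; zero; suc; inject≤)
open import Data.Integer using (ℤ; _+_; _≟_; _<?_)
open import Data.Nat.Base using (ℕ; zero; suc; _≤_; z≤n; _⊔_; _≤′_; ≤′-refl; ≤′-step)
open import Data.Nat.Properties using (+-monoʳ-≤; m≤m⊔n; m≤n⊔m; ≤⇒≤′)
open import Data.Product.Base using (∃-syntax; _,_; proj₁; proj₂)
open import Data.Sum.Base using (inj₁; inj₂)
open import Data.Vec.Base using (Vec; []; _∷_; _++_; lookup; tabulate)
open import Data.Vec.Properties using (lookup∘tabulate)
open import Function.Base using (_∘_)
open import Function.Bundles using (_⇔_; mk⇔)
open import Level using (0ℓ)
open import Relation.Binary.PropositionalEquality
  using (_≡_; refl; trans; cong; cong₂)
  renaming (sym to ≡-sym)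
open import Relation.Nullary.Decidable.Core using (does; yes; no)
open import Relation.Nullary.Decidable using (dec-true)
open import Relation.Nullary.Negation.Core using (contradiction)
open import Relation.Unary using (Pred; _∈_; _⊆_)

-- Evaluation of expressions.

app-cong : ∀ {A B : Set} {f g : A → B} {x y} → (∀ z → f z ≡ g z) → x ≡ y → f x ≡ g y
app-cong {g = g} {x = x} f≗g x≡y = trans (f≗g x) (cong g x≡y)

if-cong : ∀ {A : Set} {b c : Bool} {t u v w : A} →
          b ≡ c → t ≡ v → u ≡ w → (if b then t else u) ≡ (if c then v else w)
if-cong refl refl refl = refl

module _ {𝒜 : Symbols} {σ σ′ : Interp 𝒜} (σ≈σ′ : σ ≈ σ′) where
  mutual
    eval-cong : ∀ {n τ} (ρ : Vec ℤ n) (e : Expr 𝒜 n τ) → _≈ᵀ_ {τ} (eval σ ρ e) (eval σ′ ρ e)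
    eval-cong ρ (sym x)     = σ≈σ′ _ x
    eval-cong ρ tt          = refl
    eval-cong ρ ff          = refl
    eval-cong ρ (neg b)     = cong not (eval-cong ρ b)
    eval-cong ρ (and b c)   = cong₂ _∧_ (eval-cong ρ b) (eval-cong ρ c)
    eval-cong ρ (eq t u)    = cong₂ (λ x y → does (x ≟ y)) (eval-cong ρ t) (eval-cong ρ u)
    eval-cong ρ (lt t u)    = cong₂ (λ x y → does (x <? y)) (eval-cong ρ t) (eval-cong ρ u)
    eval-cong ρ (papp p ts) = app-cong (eval-cong ρ p) (evals-cong ρ ts)
    eval-cong ρ (var i)     = refl
    eval-cong ρ (ite b t u) = if-cong (eval-cong ρ b) (eval-cong ρ t) (eval-cong ρ u)
    eval-cong ρ (plus t c)  = cong (_+ c) (eval-cong ρ t)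
    eval-cong ρ (fapp f ts) = app-cong (eval-cong ρ f) (evals-cong ρ ts)
    eval-cong ρ (plam k b)  = λ xs → eval-cong (xs ++ ρ) b
    eval-cong ρ (flam k t)  = λ xs → eval-cong (xs ++ ρ) t

    evals-cong : ∀ {n k} (ρ : Vec ℤ n) (ts : Vec (Expr 𝒜 n int) k) → evals σ ρ ts ≡ evals σ′ ρ ts
    evals-cong ρ []       = refl
    evals-cong ρ (t ∷ ts) = cong₂ _∷_ (eval-cong ρ t) (evals-cong ρ ts)

-- Since `inject≤` keeps the numeric value of an index, this makes `ρ` a prefix of `ρ′`.
Extends : ∀ {m n} → m ≤ n → Vec ℤ m → Vec ℤ n → Set
Extends m≤n ρ ρ′ = ∀ i → lookup ρ′ (inject≤ i m≤n) ≡ lookup ρ i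

-- Carries the hypothesis under a lambda: its variables go in front, so the older positions shift by
-- the same `k` on both sides.
++-extends : ∀ {m n k} (m≤n : m ≤ n) {ρ : Vec ℤ m} {ρ′ : Vec ℤ n} (xs : Vec ℤ k) →
             Extends m≤n ρ ρ′ → Extends (+-monoʳ-≤ k m≤n) (xs ++ ρ) (xs ++ ρ′)
++-extends m≤n []       ext i       = ext i
++-extends m≤n (x ∷ xs) ext zero    = refl
++-extends m≤n (x ∷ xs) ext (suc i) = ++-extends m≤n xs ext i

module _ {𝒜 : Symbols} (σ : Interp 𝒜) where
  mutual
    eval-weaken : ∀ {m n τ} {m≤n : m ≤ n} {ρ : Vec ℤ m} {ρ′ : Vec ℤ n} → Extends m≤n ρ ρ′ →
                  (e : Expr 𝒜 m τ) → _≈ᵀ_ {τ} (eval σ ρ′ (weaken m≤n e)) (eval σ ρ e)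
    -- Both sides are `σ _ x`, but `_≈ᵀ_` only reduces once the type is known.
    eval-weaken {τ = bool}   ext (sym x) = refl
    eval-weaken {τ = int}    ext (sym x) = refl
    eval-weaken {τ = func k} ext (sym x) = λ _ → refl
    eval-weaken {τ = pred k} ext (sym x) = λ _ → refl
    eval-weaken ext tt          = refl
    eval-weaken ext ff          = refl
    eval-weaken ext (neg b)     = cong not (eval-weaken ext b)
    eval-weaken ext (and b c)   = cong₂ _∧_ (eval-weaken ext b) (eval-weaken ext c)
    eval-weaken ext (eq t u)    =
      cong₂ (λ x y → does (x ≟ y)) (eval-weaken ext t) (eval-weaken ext u)
    eval-weaken ext (lt t u)    =
      cong₂ (λ x y → does (x <? y)) (eval-weaken ext t) (eval-weaken ext u)
    eval-weaken ext (papp p ts) = app-cong (eval-weaken ext p) (evals-weaken ext ts)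
    eval-weaken ext (var i)     = ext i
    eval-weaken ext (ite b t u) =
      if-cong (eval-weaken ext b) (eval-weaken ext t) (eval-weaken ext u)
    eval-weaken ext (plus t c)  = cong (_+ c) (eval-weaken ext t)
    eval-weaken ext (fapp f ts) = app-cong (eval-weaken ext f) (evals-weaken ext ts)
    eval-weaken {m≤n = m≤n} ext (plam k b)  = λ xs → eval-weaken (++-extends m≤n xs ext) b
    eval-weaken {m≤n = m≤n} ext (flam k t)  = λ xs → eval-weaken (++-extends m≤n xs ext) t

    evals-weaken : ∀ {m n k} {m≤n : m ≤ n} {ρ : Vec ℤ m} {ρ′ : Vec ℤ n} → Extends m≤n ρ ρ′ →
                   (ts : Vec (Expr 𝒜 m int) k) → evals σ ρ′ (weakens m≤n ts) ≡ evals σ ρ ts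
    evals-weaken ext []       = refl
    evals-weaken ext (t ∷ ts) = cong₂ _∷_ (eval-weaken ext t) (evals-weaken ext ts)

module _ {𝒜 ℬ : Symbols} (v : Named 𝒜 ℬ) (σ : Interp ℬ) where
  mutual
    eval-subst : ∀ {n τ} (ρ : Vec ℤ n) (e : Expr 𝒜 n τ) →
                 _≈ᵀ_ {τ} (eval σ ρ (subst v e)) (eval (⟨ v ⟩ᴺ σ) ρ e)
    -- The replacement is closed, so its environment is empty and every `ρ` extends it vacuously.
    eval-subst ρ (sym x)     = eval-weaken σ (λ ()) (v _ x)
    eval-subst ρ tt          = refl
    eval-subst ρ ff          = refl
    eval-subst ρ (neg b)     = cong not (eval-subst ρ b)
    eval-subst ρ (and b c)   = cong₂ _∧_ (eval-subst ρ b) (eval-subst ρ c)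
    eval-subst ρ (eq t u)    = cong₂ (λ x y → does (x ≟ y)) (eval-subst ρ t) (eval-subst ρ u)
    eval-subst ρ (lt t u)    = cong₂ (λ x y → does (x <? y)) (eval-subst ρ t) (eval-subst ρ u)
    eval-subst ρ (papp p ts) = app-cong (eval-subst ρ p) (evals-subst ρ ts)
    eval-subst ρ (var i)     = refl
    eval-subst ρ (ite b t u) = if-cong (eval-subst ρ b) (eval-subst ρ t) (eval-subst ρ u)
    eval-subst ρ (plus t c)  = cong (_+ c) (eval-subst ρ t)
    eval-subst ρ (fapp f ts) = app-cong (eval-subst ρ f) (evals-subst ρ ts)
    eval-subst ρ (plam k b)  = λ xs → eval-subst (xs ++ ρ) b
    eval-subst ρ (flam k t)  = λ xs → eval-subst (xs ++ ρ) t

    evals-subst : ∀ {n k} (ρ : Vec ℤ n) (ts : Vec (Expr 𝒜 n int) k) →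
                  evals σ ρ (substs v ts) ≡ evals (⟨ v ⟩ᴺ σ) ρ ts
    evals-subst ρ []       = refl
    evals-subst ρ (t ∷ ts) = cong₂ _∷_ (eval-subst ρ t) (evals-subst ρ ts)

-- Shannon expansion (x ⇒ F) ∧ (¬ x ⇒ G), with implications written using ¬ and ∧.
booleanFormula : ∀ {𝒜 m} → (Fin m → 𝒜 bool) → (Vec Bool m → Bool) → E 𝒜 bool
booleanFormula {m = zero}  x f = if f [] then tt else ff
booleanFormula {m = suc _} x f =
  and (neg (and (sym (x zero))       (neg (booleanFormula (x ∘ suc) (f ∘ (true ∷_))))))
      (neg (and (neg (sym (x zero))) (neg (booleanFormula (x ∘ suc) (f ∘ (false ∷_))))))

booleanFormula-correct : ∀ {𝒜 m} (x : Fin m → 𝒜 bool) (f : Vec Bool m → Bool) (σ : Interp 𝒜) →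
                         ⟨ booleanFormula x f ⟩ σ ≡ f (tabulate (σ bool ∘ x))
booleanFormula-correct {m = zero} x f σ with f []
... | true  = refl
... | false = refl
booleanFormula-correct {m = suc _} x f σ with σ bool (x zero)
-- The second conjunct has become `true` but stands on the right, where `_∧_` does not compute it
-- away; in the other case the first conjunct is `true` and vanishes by computation.
... | true  = trans (∧-identityʳ _) (trans (not-involutive _)
                (booleanFormula-correct (x ∘ suc) (f ∘ (true ∷_)) σ))
... | false = trans (not-involutive _)
                (booleanFormula-correct (x ∘ suc) (f ∘ (false ∷_)) σ)

-- Increasing chains over a finite set.

Increasing : ∀ {A : Set} → (ℕ → Pred A 0ℓ) → Set
Increasing P = ∀ {m n} → m ≤ n → P m ⊆ P n

module _ (em : ExcludedMiddle 0ℓ) where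

  -- Induction on the length: the vectors split by their first bit into two smaller cubes, and the
  -- larger of the two bounds serves both. On the one-point cube, excluded middle decides whether
  -- the point ever enters the chain.
  increasing-stabilises : ∀ {m} {P : ℕ → Pred (Vec Bool m) 0ℓ} → Increasing P →
                          ∃[ N ] (∀ n → P n ⊆ P N)
  increasing-stabilises {zero} {P} mono with em {∃[ n ] P n []}
  ... | yes (N , p) = N , λ { n {[]} _ → p }
  ... | no  ¬p      = 0 , λ { n {[]} p → contradiction (n , p) ¬p }
  increasing-stabilises {suc m} {P} mono =
    let N₁ , stable₁ = increasing-stabilises {P = λ n v → P n (true ∷ v)} (λ m≤n → mono m≤n)
        N₀ , stable₀ = increasing-stabilises {P = λ n v → P n (false ∷ v)} (λ m≤n → mono m≤n)
    in N₁ ⊔ N₀ , λ where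
         n {true ∷ v}  p → mono (m≤m⊔n N₁ N₀) (stable₁ n p)
         n {false ∷ v} p → mono (m≤n⊔m N₁ N₀) (stable₀ n p)

-- Abstract states as bit vectors, and closure of the reachable sets under `_≈_`.

module _ (sys : System) where
  open Semantics sys

  bits : AState → Vec Bool #𝒫
  bits a = tabulate (a bool ∘ bsym)

  fromBits : Vec Bool #𝒫 → AState
  fromBits v bool (bsym i) = lookup v i

  fromBits-bits : ∀ a → fromBits (bits a) ≈ a
  fromBits-bits a bool (bsym i) = lookup∘tabulate (a bool ∘ bsym) i

  ≈-refl : ∀ {a : AState} → a ≈ a
  ≈-refl bool (bsym i) = refl

  ≈-sym : ∀ {a b : AState} → a ≈ b → b ≈ a
  ≈-sym a≈b bool (bsym i) = ≡-sym (a≈b bool (bsym i))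

  ≈-trans : ∀ {a b c : AState} → a ≈ b → b ≈ c → a ≈ c
  ≈-trans a≈b b≈c bool (bsym i) = trans (a≈b bool (bsym i)) (b≈c bool (bsym i))

  α⋃-resp-≈ : ∀ {S a b} → a ≈ b → a ∈ α⋃ S → b ∈ α⋃ S
  α⋃-resp-≈ a≈b (s , s∈S , σₓ , a≈) = s , s∈S , σₓ , ≈-trans (≈-sym a≈b) a≈

  -- Encoding a state as bits and decoding it returns the state only up to `_≈_`, so moving
  -- membership along this round trip needs closure. It holds because `α` is itself defined up to
  -- `_≈_`.
  RAᵢ-resp-≈ : ∀ n {a b} → a ≈ b → a ∈ RAᵢ n → b ∈ RAᵢ n
  RAᵢ-resp-≈ zero    a≈b a∈        = α⋃-resp-≈ a≈b a∈
  RAᵢ-resp-≈ (suc n) a≈b (inj₁ a∈) = inj₁ (RAᵢ-resp-≈ n a≈b a∈)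
  RAᵢ-resp-≈ (suc n) a≈b (inj₂ a∈) = inj₂ (α⋃-resp-≈ a≈b a∈)

  RAᵢ-increasing : Increasing RAᵢ
  RAᵢ-increasing m≤n = go (≤⇒≤′ m≤n)
    where
    go : ∀ {m n} → m ≤′ n → RAᵢ m ⊆ RAᵢ n
    go ≤′-refl       a∈ = a∈
    go (≤′-step m≤n) a∈ = inj₁ (go m≤n a∈)

  -- From an induction proof to the abstract property.

  *-correct : ∀ χ s σₓ → ⟨ χ * ⟩ (s · σₓ) ≡ ⟨ χ ⟩ (⟨ φ ⟩ᴺ (s · σₓ))
  *-correct χ s σₓ = eval-subst φ (s · σₓ) [] χ

  Models : E 𝒫 bool → Pred AState 0ℓ
  Models χ a = ⟨ χ ⟩ a ≡ true

  γ-Models⇒∀𝒳 : ∀ χ {s} → s ∈ γ (Models χ) → s ∈ ∀𝒳 (χ *)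
  γ-Models⇒∀𝒳 χ s∈γ σₓ = trans (*-correct χ _ σₓ) (s∈γ σₓ)

  ∀𝒳⇒γ-Models : ∀ χ {s} → s ∈ ∀𝒳 (χ *) → s ∈ γ (Models χ)
  ∀𝒳⇒γ-Models χ s∈ σₓ = trans (≡-sym (*-correct χ _ σₓ)) (s∈ σₓ)

  -- One half of the Galois connection between `α` and `γ`: S ⊆ γ(A) gives α(S) ⊆ A, with A the
  -- models of `χ`.
  α⋃-∀𝒳⊆Models : ∀ χ {S} → S ⊆ ∀𝒳 (χ *) → α⋃ S ⊆ Models χ
  α⋃-∀𝒳⊆Models χ S⊆ (s , s∈S , σₓ , a≈) =
    trans (eval-cong a≈ [] χ) (∀𝒳⇒γ-Models χ (S⊆ s∈S) σₓ)

  RAᵢ⊆Models : ∀ χ → Inductive (∀𝒳 (χ *)) → ∀ n → RAᵢ n ⊆ Models χ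
  RAᵢ⊆Models χ (base , _) zero = α⋃-∀𝒳⊆Models χ (base _)
  RAᵢ⊆Models χ ind (suc n) (inj₁ a∈) = RAᵢ⊆Models χ ind n a∈
  RAᵢ⊆Models χ ind@(_ , step) (suc n) (inj₂ a∈) =
    α⋃-∀𝒳⊆Models χ
      -- By the induction hypothesis and monotonicity of `γ`, `s` satisfies the inductive property,
      -- which then passes to its successor.
      (λ (s , s∈γ , t∈N) → step s _ t∈N (γ-Models⇒∀𝒳 χ (RAᵢ⊆Models χ ind n ∘ s∈γ)))
      a∈

  inductionProof⇒abstractProperty : ∀ ψ → HasInductionProof ψ → AbstractProperty ψ
  inductionProof⇒abstractProperty ψ (χ , χ⇒ψ , ind) a (n , _ , a∈) =
    χ⇒ψ a (RAᵢ⊆Models χ ind n a∈)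

  -- From the abstract property to an induction proof.

  module _ (em : ExcludedMiddle 0ℓ) where

    RAᵢ-stabilises : ∃[ N ] (∀ n → RAᵢ n ⊆ RAᵢ N)
    RAᵢ-stabilises =
      let N , stable = increasing-stabilises em {P = λ n → RAᵢ n ∘ fromBits}
                         (λ m≤n → RAᵢ-increasing m≤n)
      in N , λ n {a} a∈ →
           RAᵢ-resp-≈ N (fromBits-bits a) (stable n (RAᵢ-resp-≈ n (≈-sym (fromBits-bits a)) a∈))

    -- Excluded middle turns membership into a Boolean function. The formula sees a state only
    -- through its bits, so it can define only sets closed under `_≈_`.
    characteristic : Pred AState 0ℓ → E 𝒫 bool
    characteristic A = booleanFormula bsym (λ v → does (em {fromBits v ∈ A}))

    module _ {A : Pred AState 0ℓ} (resp : ∀ {a b} → a ≈ b → a ∈ A → b ∈ A) where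

      ∈⇒characteristic : A ⊆ Models (characteristic A)
      ∈⇒characteristic {a} a∈ =
        trans (booleanFormula-correct bsym _ a)
              (dec-true em (resp (≈-sym (fromBits-bits a)) a∈))

      characteristic⇒∈ : Models (characteristic A) ⊆ A
      characteristic⇒∈ {a} χa
        -- Abstracting the decision together with the equation turns the latter into `false ≡ true`
        -- in the negative case.
        with em {fromBits (bits a) ∈ A} | trans (≡-sym (booleanFormula-correct bsym _ a)) χa
      ... | yes b∈ | _ = resp (fromBits-bits a) b∈
      ... | no  _  | ()

    abstractProperty⇒inductionProof : ∀ ψ → AbstractProperty ψ → HasInductionProof ψ
    abstractProperty⇒inductionProof ψ abs = χ , χ⇒ψ , base , step
      where
      N = proj₁ RAᵢ-stabilises
      stable = proj₂ RAᵢ-stabilises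
      χ = characteristic (RAᵢ N)

      models⇒RAᵢ : Models χ ⊆ RAᵢ N
      models⇒RAᵢ = characteristic⇒∈ (RAᵢ-resp-≈ N)

      RAᵢ⇒models : ∀ n → RAᵢ n ⊆ Models χ
      RAᵢ⇒models n a∈ = ∈⇒characteristic (RAᵢ-resp-≈ N) (stable n a∈)

      χ⇒ψ : ∀ a → ⟨ χ ⟩ a ≡ true → ⟨ ψ ⟩ a ≡ true
      -- `N` is a stationary index: one inclusion is built into the union, the other is stability.
      -- So every model of `χ` lies in `RA`.
      χ⇒ψ a χa = abs a (N , (inj₁ , stable (suc N)) , models⇒RAᵢ χa)

      base : ∀ s → s ∈ Q⁰C → s ∈ ∀𝒳 (χ *)
      base s s∈ = γ-Models⇒∀𝒳 χ λ σₓ → RAᵢ⇒models 0 (s , s∈ , σₓ , ≈-refl)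

      step : ∀ s t → t ∈ NC s → s ∈ ∀𝒳 (χ *) → t ∈ ∀𝒳 (χ *)
      step s t t∈ s∈ = γ-Models⇒∀𝒳 χ λ σₓ →
        -- The abstractions of `t` appear one stage later, at `suc N`; stability brings them back to
        -- stage `N`, where `χ` is defined.
        RAᵢ⇒models (suc N)
          (inj₂ (t , (s , models⇒RAᵢ ∘ ∀𝒳⇒γ-Models χ s∈ , t∈) , σₓ , ≈-refl))

theorem7p8 : ExcludedMiddle 0ℓ → (sys : System) (ψ : E (System.𝒫 sys) bool) →
    Semantics.AbstractProperty sys ψ ⇔ Semantics.HasInductionProof sys ψ
theorem7p8 em sys ψ =
  mk⇔ (abstractProperty⇒inductionProof sys em ψ) (inductionProof⇒abstractProperty sys ψ)
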